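{- Binary concatenation is definable in the first-order theory $T_1$ of the structure $\mathfrak{S}_1=\langle\Sigma^*,1,2,\sqsubseteq,\sqsupseteq\rangle$; that is, there is a first-order formula $\varphi(x,y,z)$ in the vocabulary $\{\underline{1},\underline{2},\sqsubseteq,\sqsupseteq\}$ such that for all $r,s,t\in\Sigma^*$, $\mathfrak{S}_1\models\varphi(r,s,t)$ if and only if $r^\frown s=t$.
   Context: $\Sigma^*$ is the set of finite words over the alphabet $\{1,2\}$, including the empty word; $^\frown$ is concatenation of words. The constants $\underline{1},\underline{2}$ denote the one-letter words $1,2$. $s\sqsubseteq t$ means that $s$ is an initial segment of $t$ ($t=s^\frown u$ for some $u\in\Sigma^*$), and $s\sqsupseteq t$ means that $s$ is an end segment of $t$ ($t=u^\frown s$ for some $u\in\Sigma^*$). Formulas are first-order with equality. -}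

module Defs where

open import Data.Fin using (Fin)
open import Data.List using (List; []; _∷_; _++_)
open import Data.Nat using (ℕ; suc)
open import Data.Product using (_×_; ∃-syntax)
open import Data.Sum using (_⊎_)
open import Data.Vec using (Vec; lookup; _∷_)
open import Relation.Binary.PropositionalEquality using (_≡_)
open import Relation.Nullary using (¬_)

data Letter : Set where
  one two : Letter

Word : Set
Word = List Letter

infix 4 _⊑_ _⊒_

_⊑_ : Word → Word → Set
s ⊑ t = ∃[ u ] t ≡ s ++ u

-- s is an end segment of t: here too the shorter word is on the left,
-- so this is not the converse of _⊑_.
_⊒_ : Word → Word → Set
s ⊒ t = ∃[ u ] t ≡ u ++ s

infix  7 _`≡_ _`⊑_ _`⊒_
infix  6 `¬_
infixr 5 _`∧_
infixr 4 _`∨_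
infixr 3 _`⇒_
infix  2 `∀_ `∃_

data Term (n : ℕ) : Set where
  var   : Fin n → Term n
  `1 `2 : Term n

-- n bounds the free variables, which are de Bruijn indices: a quantifier
-- binds index 0 and shifts the others up by one.
data Formula (n : ℕ) : Set where
  _`≡_ _`⊑_ _`⊒_ : Term n → Term n → Formula n
  `¬_            : Formula n → Formula n
  _`∧_ _`∨_ _`⇒_ : Formula n → Formula n → Formula n
  `∀_ `∃_        : Formula (suc n) → Formula n

record Structure : Set₁ where
  field
    Carrier     : Set
    c₁ c₂       : Carrier
    InitSeg     : Carrier → Carrier → Set
    EndSeg      : Carrier → Carrier → Set

open Structure

𝔖₁ : Structure
𝔖₁ = record
  { Carrier = Word
  ; c₁      = one ∷ []
  ; c₂      = two ∷ []
  ; InitSeg = _⊑_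
  ; EndSeg  = _⊒_
  }

eval : ∀ 𝔐 {n} → Vec (Carrier 𝔐) n → Term n → Carrier 𝔐
eval 𝔐 ρ (var i) = lookup ρ i
eval 𝔐 ρ `1      = c₁ 𝔐
eval 𝔐 ρ `2      = c₂ 𝔐

infix 1 _⊨_[_]

-- Tarski satisfaction, read in the constructive metatheory.  Assuming
-- excluded middle it is classical satisfaction; without it, the classical
-- ∨ and ∃ are available as the formulas ¬(¬φ ∧ ¬ψ) and ¬∀¬φ.
_⊨_[_] : ∀ 𝔐 {n} → Formula n → Vec (Carrier 𝔐) n → Set
𝔐 ⊨ a `≡ b [ ρ ] = eval 𝔐 ρ a ≡ eval 𝔐 ρ b
𝔐 ⊨ a `⊑ b [ ρ ] = InitSeg 𝔐 (eval 𝔐 ρ a) (eval 𝔐 ρ b)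
𝔐 ⊨ a `⊒ b [ ρ ] = EndSeg 𝔐 (eval 𝔐 ρ a) (eval 𝔐 ρ b)
𝔐 ⊨ `¬ φ   [ ρ ] = ¬ (𝔐 ⊨ φ [ ρ ])
𝔐 ⊨ φ `∧ ψ [ ρ ] = (𝔐 ⊨ φ [ ρ ]) × (𝔐 ⊨ ψ [ ρ ])
𝔐 ⊨ φ `∨ ψ [ ρ ] = (𝔐 ⊨ φ [ ρ ]) ⊎ (𝔐 ⊨ ψ [ ρ ])
𝔐 ⊨ φ `⇒ ψ [ ρ ] = (𝔐 ⊨ φ [ ρ ]) → (𝔐 ⊨ ψ [ ρ ])
𝔐 ⊨ `∀ φ   [ ρ ] = ∀ w → 𝔐 ⊨ φ [ w ∷ ρ ]
𝔐 ⊨ `∃ φ   [ ρ ] = ∃[ w ] (𝔐 ⊨ φ [ w ∷ ρ ])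

{-# OPTIONS --safe #-}
module Submission where

-- The graph of x ++ - is the least relation containing (x , []) and closed under
-- appending one letter to both components, so x ++ y ≡ z as soon as (z , y) lies
-- in some set R of pairs each of which is (x , []) or arises from a pair in R by
-- appending a letter; induction on y shows this whatever R is. A finite such R is
-- given by two words, through the blocks 1 2ᵐ 1 u 1 2ᵐ 1 and 1 2ᵐ 1 v 1 2ᵐ 1 with a
-- common tag m. Blocks are definable since 2ᵐ ++ b with b starting with 1 is the
-- word that begins with 2ᵐ 1 and whose longest end segment starting with 1 is b
-- (and dually for b ++ 2ᵐ); they are uniquely readable if the tags are longer
-- than all the coded words.

open import Defs
open import Data.Fin using (Fin; suc; _↑ʳ_)
open import Data.Fin.Patterns
open import Data.List using ([]; _∷_; _++_; _∷ʳ_; length; replicate; take)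
open import Data.List.Properties
open import Data.Nat using (ℕ; zero; suc; _+_; _∸_; _≤_; _<_; z≤n; s≤s)
open import Data.Nat.Properties
  using (≤-refl; ≤-trans; ≤-reflexive; <-irrefl; <⇒≤; m≤m+n; m≤n+m; m≤n⇒m≤1+n; m⊓n≤n;
         m+n∸m≡n; +-suc; +-identityʳ; +-monoʳ-≤; suc-injective)
open import Data.Product using (Σ-syntax; _×_; _,_; ∃-syntax)
open import Data.Sum using (_⊎_; inj₁; inj₂)
open import Data.Vec using (Vec; lookup; _∷_; [])
open import Function.Bundles using (_⇔_; mk⇔; Equivalence)
open import Relation.Nullary using (¬_; contradiction)
open import Relation.Binary.PropositionalEquality
  using (_≡_; refl; sym; trans; cong; cong₂; subst; module ≡-Reasoning)

open Equivalence using (to; from)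

private
  variable
    n : ℕ

-- Segments of words and runs of 2s.

⊑-antisym : ∀ {s t} → s ⊑ t → t ⊑ s → s ≡ t
⊑-antisym {s} (a , refl) (b , q) = sym (trans (cong (s ++_) a≡[]) (++-identityʳ s))
  where
  a≡[] : a ≡ []
  a≡[] = ++-conicalˡ a b (++-identityʳ-unique s (trans q (++-assoc s a b)))

⊒-antisym : ∀ {s t} → s ⊒ t → t ⊒ s → s ≡ t
⊒-antisym {s} (a , refl) (b , q) = sym (cong (_++ s) a≡[])
  where
  a≡[] : a ≡ []
  a≡[] = ++-conicalʳ b a (++-identityˡ-unique (b ++ a) (trans q (sym (++-assoc b a s))))

⊒-trans : ∀ {r s t} → r ⊒ s → s ⊒ t → r ⊒ t
⊒-trans {r} (a , refl) (b , refl) = b ++ a , sym (++-assoc b a r)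

twos : ℕ → Word
twos m = replicate m two

one∉twos : ∀ m {s t} → ¬ twos m ≡ s ++ one ∷ t
one∉twos (suc m) {[]}    ()
one∉twos (suc m) {x ∷ s} p = one∉twos m {s} (∷-injectiveʳ p)

-- An end segment with first letter 1 cannot start inside the leading run of 2s.
strip-twos : ∀ m {s t} → one ∷ s ⊒ twos m ++ t → one ∷ s ⊒ t
strip-twos zero    p             = p
strip-twos (suc m) ([] , ())
strip-twos (suc m) (_ ∷ u , p) = strip-twos m (u , ∷-injectiveʳ p)

-- Dual to `strip-twos`. The run of 2s is at the far end, so `v` and `u` are consumed letter by
-- letter; a `v` that outlasts `u` would put a 1 among the 2s.
prefix-before-twos : ∀ m v u → v ∷ʳ one ⊑ (u ∷ʳ one) ++ twos m → v ∷ʳ one ⊑ u ∷ʳ one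
prefix-before-twos m []      []      p       = [] , refl
prefix-before-twos m (x ∷ v) []      (c , p) =
  contradiction (trans (∷-injectiveʳ p) (++-assoc v (one ∷ []) c)) (one∉twos m {v})
prefix-before-twos m []      (y ∷ u) (c , p) with refl ← ∷-injectiveˡ p = u ∷ʳ one , refl
prefix-before-twos m (x ∷ v) (y ∷ u) (c , p) with refl ← ∷-injectiveˡ p
  with d , q ← prefix-before-twos m v u (c , ∷-injectiveʳ p) = d , cong (x ∷_) q

twos-one-injective : ∀ j k {s t} → twos j ++ one ∷ s ≡ twos k ++ one ∷ t → j ≡ k × s ≡ t
twos-one-injective zero    zero    refl = refl , refl
twos-one-injective (suc j) (suc k) p with twos-one-injective j k (∷-injectiveʳ p)
... | refl , q = refl , q

-- Definable relations

letter : Letter → Term n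
letter one = `1
letter two = `2

eval-letter : ∀ a {ρ : Vec Word n} → eval 𝔖₁ ρ (letter a) ≡ a ∷ []
eval-letter one = refl
eval-letter two = refl

-- All conjuncts but the second say that `y` covers `x` in the order of initial segments (of end
-- segments in the second formula); the second conjunct fixes the added letter.
`Snoc `Cons : Letter → Fin n → Fin n → Formula n
`Snoc a x y =
  var x `⊑ var y `∧ letter a `⊒ var y `∧ `¬ (var x `≡ var y) `∧
  (`∀ var 0F `⊑ var (suc y) `⇒ var 0F `⊑ var (suc x) `∨ var 0F `≡ var (suc y))
`Cons a x y =
  var x `⊒ var y `∧ letter a `⊑ var y `∧ `¬ (var x `≡ var y) `∧
  (`∀ var 0F `⊒ var (suc y) `⇒ var 0F `⊒ var (suc x) `∨ var 0F `≡ var (suc y))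

∷ʳ-⊑ : ∀ z x {a} → z ⊑ x ∷ʳ a → z ⊑ x ⊎ z ≡ x ∷ʳ a
∷ʳ-⊑ []      x       p = inj₁ (x , refl)
∷ʳ-⊑ (b ∷ z) []      (c , p) with refl ← ∷-injectiveˡ p
  with refl ← ++-conicalˡ z c (sym (∷-injectiveʳ p)) = inj₂ refl
∷ʳ-⊑ (b ∷ z) (d ∷ x) (c , p) with refl ← ∷-injectiveˡ p
  with ∷ʳ-⊑ z x (c , ∷-injectiveʳ p)
... | inj₁ (e , q) = inj₁ (e , cong (b ∷_) q)
... | inj₂ q       = inj₂ (cong (b ∷_) q)

∷-⊒ : ∀ {z x a} → z ⊒ a ∷ x → z ⊒ x ⊎ z ≡ a ∷ x
∷-⊒ ([] , p)    = inj₂ (sym p)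
∷-⊒ (_ ∷ u , p) = inj₁ (u , ∷-injectiveʳ p)

snoc : ∀ a (x y : Fin n) ρ → (𝔖₁ ⊨ `Snoc a x y [ ρ ]) ⇔ (lookup ρ y ≡ lookup ρ x ∷ʳ a)
snoc a x y ρ = mk⇔ sound complete
  where
  X = lookup ρ x
  Y = lookup ρ y

  sound : 𝔖₁ ⊨ `Snoc a x y [ ρ ] → Y ≡ X ∷ʳ a
  sound (([] , p) , _ , X≢Y , _) = contradiction (sym (trans p (++-identityʳ X))) X≢Y
  sound ((b ∷ c , p) , (d , q) , _ , h)
    -- The covering clause is tested at `X` with the next letter of `Y`: this is too long to be an
    -- initial segment of `X`, so it is all of `Y`.
    with h (X ∷ʳ b) (c , trans p (sym (++-assoc X (b ∷ []) c)))
  ... | inj₁ (e , r) = contradiction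
          (++-identityʳ-unique X (trans r (++-assoc X (b ∷ []) e))) λ ()
  ... | inj₂ r = trans (sym r) (cong (X ∷ʳ_) (∷ʳ-injectiveʳ X d
          (trans r (trans q (cong (d ++_) (eval-letter a))))))

  complete : Y ≡ X ∷ʳ a → 𝔖₁ ⊨ `Snoc a x y [ ρ ]
  complete p =
    (a ∷ [] , p) ,
    (X , trans p (cong (X ++_) (sym (eval-letter a)))) ,
    (λ q → contradiction (++-identityʳ-unique X (trans q p)) λ ()) ,
    λ z → subst (λ Y → z ⊑ Y → z ⊑ X ⊎ z ≡ Y) (sym p) (∷ʳ-⊑ z X)

cons : ∀ a (x y : Fin n) ρ → (𝔖₁ ⊨ `Cons a x y [ ρ ]) ⇔ (lookup ρ y ≡ a ∷ lookup ρ x)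
cons a x y ρ = mk⇔ sound complete
  where
  X = lookup ρ x
  Y = lookup ρ y

  sound : 𝔖₁ ⊨ `Cons a x y [ ρ ] → Y ≡ a ∷ X
  sound ((c , p) , (d , q) , X≢Y , h) with subst (λ s → Y ≡ s ++ d) (eval-letter a) q
  ... | q′ with c
  ... | [] = contradiction (sym p) X≢Y
  ... | b ∷ c′ with refl ← ∷-injectiveˡ (trans (sym q′) p)
    -- Here the test word is `Y` without its first letter: it differs from `Y`, so it is an end
    -- segment of `X` and hence equal to `X`.
    with h (c′ ++ X) (a ∷ [] , p)
  ... | inj₁ r = trans p (cong (a ∷_) (⊒-antisym r (c′ , refl)))
  ... | inj₂ r = contradiction (++-identityˡ-unique (a ∷ []) (trans r p)) λ ()

  complete : Y ≡ a ∷ X → 𝔖₁ ⊨ `Cons a x y [ ρ ]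
  complete p =
    (a ∷ [] , p) ,
    (X , trans p (cong (_++ X) (sym (eval-letter a)))) ,
    (λ q → contradiction (++-identityˡ-unique (a ∷ []) (trans q p)) λ ()) ,
    λ z → subst (λ Y → z ⊒ Y → z ⊒ X ⊎ z ≡ Y) (sym p) ∷-⊒

-- Containing a 1 is expressed as having an initial segment that ends in 1.
`Twos : Fin n → Formula n
`Twos k = `∀ `¬ (var 0F `⊑ var (suc k) `∧ `1 `⊒ var 0F)

one-free⇒twos : ∀ k → (∀ s → ¬ (s ⊑ k × (one ∷ []) ⊒ s)) → ∃[ m ] k ≡ twos m
one-free⇒twos []        h = 0 , refl
one-free⇒twos (one ∷ k) h = contradiction ((k , refl) , ([] , refl)) (h (one ∷ []))
one-free⇒twos (two ∷ k) h
  with one-free⇒twos k (λ { s ((c , p) , (d , q)) →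
         h (two ∷ s) ((c , cong (two ∷_) p) , (two ∷ d , cong (two ∷_) q)) })
... | m , refl = suc m , refl

twos-sat : ∀ (k : Fin n) ρ → (𝔖₁ ⊨ `Twos k [ ρ ]) ⇔ (∃[ m ] lookup ρ k ≡ twos m)
twos-sat k ρ = mk⇔ (one-free⇒twos (lookup ρ k)) complete
  where
  complete : ∃[ m ] lookup ρ k ≡ twos m → 𝔖₁ ⊨ `Twos k [ ρ ]
  complete (m , p) s ((c , q) , (d , refl)) = one∉twos m {d}
    (trans (sym p) (trans q (++-assoc d (one ∷ []) c)))

-- These mean f ≡ k ++ b and f ≡ d ++ k only if k consists of 2s, b starts with 1
-- and d ends with 1.
`TwosPrepend `TwosAppend : Fin n → Fin n → Fin n → Formula n
`TwosPrepend k b f =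
  (`∃ `Snoc one (suc k) 0F `∧ var 0F `⊑ var (suc f)) `∧ var b `⊒ var f `∧
  (`∀ `1 `⊑ var 0F `⇒ var 0F `⊒ var (suc f) `⇒ var 0F `⊒ var (suc b))
`TwosAppend k d f =
  (`∃ `Cons one (suc k) 0F `∧ var 0F `⊒ var (suc f)) `∧ var d `⊑ var f `∧
  (`∀ `1 `⊒ var 0F `⇒ var 0F `⊑ var (suc f) `⇒ var 0F `⊑ var (suc d))

twosPrepend : ∀ (k b f : Fin n) ρ m {b′} → lookup ρ k ≡ twos m → lookup ρ b ≡ one ∷ b′ →
  (𝔖₁ ⊨ `TwosPrepend k b f [ ρ ]) ⇔ (lookup ρ f ≡ twos m ++ lookup ρ b)
twosPrepend k b f ρ m {b′} k≡ b≡ = mk⇔ sound complete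
  where
  B = lookup ρ b
  F = lookup ρ f

  sound : 𝔖₁ ⊨ `TwosPrepend k b f [ ρ ] → F ≡ twos m ++ B
  sound ((a , s , (u , p)) , (v , q) , h) = trans F≡ (cong (twos m ++_) one∷u≡B)
    where
    F≡ : F ≡ twos m ++ one ∷ u
    F≡ = begin
      F                              ≡⟨ p ⟩
      a ++ u                         ≡⟨ cong (_++ u) (to (snoc one (suc k) 0F (a ∷ ρ)) s) ⟩
      (lookup ρ k ∷ʳ one) ++ u       ≡⟨ ++-assoc (lookup ρ k) _ u ⟩
      lookup ρ k ++ one ∷ u          ≡⟨ cong (_++ one ∷ u) k≡ ⟩
      twos m ++ one ∷ u              ∎
      where open ≡-Reasoning
    -- The maximality of `B` puts `one ∷ u` inside `B`; conversely `B` starts with 1, so it cannot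
    -- begin within the leading 2s.
    one∷u≡B : one ∷ u ≡ B
    one∷u≡B = ⊒-antisym (h (one ∷ u) (u , refl) (twos m , F≡))
      (subst (_⊒ one ∷ u) (sym b≡)
        (strip-twos m (v , trans (sym F≡) (trans q (cong (v ++_) b≡)))))

  complete : F ≡ twos m ++ B → 𝔖₁ ⊨ `TwosPrepend k b f [ ρ ]
  complete p =
    (lookup ρ k ∷ʳ one , from (snoc one (suc k) 0F (_ ∷ ρ)) refl , b′ ,
      trans p (trans (cong₂ _++_ (sym k≡) b≡) (sym (++-assoc (lookup ρ k) (one ∷ []) b′)))) ,
    (twos m , p) ,
    λ { c (c′ , refl) (v , q) → strip-twos m (v , trans (sym p) q) }

twosAppend : ∀ (k d f : Fin n) ρ m {d′} → lookup ρ k ≡ twos m → lookup ρ d ≡ d′ ∷ʳ one →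
  (𝔖₁ ⊨ `TwosAppend k d f [ ρ ]) ⇔ (lookup ρ f ≡ lookup ρ d ++ twos m)
twosAppend k d f ρ m {d′} k≡ d≡ = mk⇔ sound complete
  where
  D = lookup ρ d
  F = lookup ρ f

  sound : 𝔖₁ ⊨ `TwosAppend k d f [ ρ ] → F ≡ D ++ twos m
  sound ((a , s , (u , p)) , (v , q) , h) = trans F≡ (cong (_++ twos m) u∷ʳone≡D)
    where
    F≡ : F ≡ (u ∷ʳ one) ++ twos m
    F≡ = begin
      F                              ≡⟨ p ⟩
      u ++ a                         ≡⟨ cong (u ++_) (to (cons one (suc k) 0F (a ∷ ρ)) s) ⟩
      u ++ one ∷ lookup ρ k          ≡⟨ cong (λ k → u ++ one ∷ k) k≡ ⟩
      u ++ one ∷ twos m              ≡⟨ ++-assoc u _ (twos m) ⟨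
      (u ∷ʳ one) ++ twos m           ∎
      where open ≡-Reasoning
    u∷ʳone≡D : u ∷ʳ one ≡ D
    u∷ʳone≡D = ⊑-antisym (h (u ∷ʳ one) (u , refl) (twos m , F≡))
      (subst (_⊑ u ∷ʳ one) (sym d≡)
        (prefix-before-twos m d′ u (v , trans (sym F≡) (trans q (cong (_++ v) d≡)))))

  complete : F ≡ D ++ twos m → 𝔖₁ ⊨ `TwosAppend k d f [ ρ ]
  complete p =
    (one ∷ lookup ρ k , from (cons one (suc k) 0F (_ ∷ ρ)) refl , d′ ,
      trans p (trans (cong₂ _++_ d≡ (sym k≡)) (++-assoc d′ (one ∷ []) (lookup ρ k)))) ,
    (twos m , p) ,
    λ { c (c′ , refl) (v , q) → subst (c′ ∷ʳ one ⊑_) (sym d≡)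
          (prefix-before-twos m c′ d′
            (v , trans (cong (_++ twos m) (sym d≡)) (trans (sym p) q))) }

-- Sets of tagged words coded by a single word

block : ℕ → Word → Word → Word
block m u q = one ∷ twos m ++ one ∷ u ++ one ∷ twos m ++ one ∷ q

-- The free remainder `q` turns the occurrence of a block anywhere in `w` into a condition on end
-- segments.
Tagged : Word → ℕ → Word → Set
Tagged w m u = ∃[ q ] block m u q ⊒ w

-- The block grows outward from `u`: indices `6F` to `1F` hold 1u, 1u1, 2ᵐ1u1, 2ᵐ1u12ᵐ and then this
-- word with a 1 added in front and behind. The inner 1s come first because attaching 2ᵐ requires a
-- 1 at that end. `0F` is the end segment of `w` that begins with the block.
`Tagged : Fin n → Fin n → Fin n → Formula n
`Tagged w k u =
  `∃ `∃ `∃ `∃ `∃ `∃ `∃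
  `Cons one (7 ↑ʳ u) 6F `∧ `Snoc one 6F 5F `∧
  `TwosPrepend (7 ↑ʳ k) 5F 4F `∧ `TwosAppend (7 ↑ʳ k) 4F 3F `∧
  `Cons one 3F 2F `∧ `Snoc one 2F 1F `∧
  var 1F `⊑ var 0F `∧ var 0F `⊒ var (7 ↑ʳ w)

block-assoc : ∀ m u q →
  (one ∷ (twos m ++ (one ∷ u) ∷ʳ one) ++ twos m) ∷ʳ one ++ q ≡ block m u q
block-assoc m u q = cong (one ∷_) (begin
  (((T ++ (one ∷ u) ∷ʳ one) ++ T) ∷ʳ one) ++ q ≡⟨ ++-assoc ((T ++ (one ∷ u) ∷ʳ one) ++ T) _ q ⟩
  ((T ++ (one ∷ u) ∷ʳ one) ++ T) ++ one ∷ q    ≡⟨ ++-assoc (T ++ (one ∷ u) ∷ʳ one) T _ ⟩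
  (T ++ (one ∷ u) ∷ʳ one) ++ T ++ one ∷ q      ≡⟨ ++-assoc T _ _ ⟩
  T ++ one ∷ u ∷ʳ one ++ T ++ one ∷ q          ≡⟨ cong (λ s → T ++ one ∷ s) (++-assoc u _ _) ⟩
  T ++ one ∷ u ++ one ∷ T ++ one ∷ q           ∎)
  where
  open ≡-Reasoning
  T = twos m

tagged : ∀ (w k u : Fin n) ρ m → lookup ρ k ≡ twos m →
  (𝔖₁ ⊨ `Tagged w k u [ ρ ]) ⇔ Tagged (lookup ρ w) m (lookup ρ u)
tagged w k u ρ m k≡ = mk⇔ sound complete
  where
  U = lookup ρ u
  T = twos m

  last-one : T ++ (one ∷ U) ∷ʳ one ≡ (T ++ one ∷ U) ∷ʳ one
  last-one = sym (++-assoc T (one ∷ U) (one ∷ []))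

  sound : 𝔖₁ ⊨ `Tagged w k u [ ρ ] → Tagged (lookup ρ w) m U
  sound (b , c , d , e , f , g , s , eb , ec , ed , ee , ef , eg , (q , g⊑s) , s⊒w)
    with refl ← to (cons one (7 ↑ʳ u) 6F (s ∷ g ∷ f ∷ e ∷ d ∷ c ∷ b ∷ ρ)) eb
    with refl ← to (snoc one 6F 5F (s ∷ g ∷ f ∷ e ∷ d ∷ c ∷ b ∷ ρ)) ec
    with refl ← to (twosPrepend (7 ↑ʳ k) 5F 4F (s ∷ g ∷ f ∷ e ∷ d ∷ c ∷ b ∷ ρ) m k≡ refl) ed
    with refl ← to (twosAppend (7 ↑ʳ k) 4F 3F (s ∷ g ∷ f ∷ e ∷ d ∷ c ∷ b ∷ ρ) m k≡ last-one) ee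
    with refl ← to (cons one 3F 2F (s ∷ g ∷ f ∷ e ∷ d ∷ c ∷ b ∷ ρ)) ef
    with refl ← to (snoc one 2F 1F (s ∷ g ∷ f ∷ e ∷ d ∷ c ∷ b ∷ ρ)) eg
    = q , subst (_⊒ lookup ρ w) (trans g⊑s (block-assoc m U q)) s⊒w

  complete : Tagged (lookup ρ w) m U → 𝔖₁ ⊨ `Tagged w k u [ ρ ]
  complete (q , p) = b , c , d , e , f , g , s ,
    from (cons one (7 ↑ʳ u) 6F ρ′) refl ,
    from (snoc one 6F 5F ρ′) refl ,
    from (twosPrepend (7 ↑ʳ k) 5F 4F ρ′ m k≡ refl) refl ,
    from (twosAppend (7 ↑ʳ k) 4F 3F ρ′ m k≡ last-one) refl ,
    from (cons one 3F 2F ρ′) refl ,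
    from (snoc one 2F 1F ρ′) refl ,
    (q , sym (block-assoc m U q)) , p
    where
    b = one ∷ U
    c = b ∷ʳ one
    d = T ++ c
    e = d ++ T
    f = one ∷ e
    g = f ∷ʳ one
    s = block m U q
    ρ′ = s ∷ g ∷ f ∷ e ∷ d ∷ c ∷ b ∷ ρ

-- A block takes its closing 1 from the code that follows, so neighbouring blocks share this letter
-- and the empty code is a single 1.
encode : (ℕ → Word) → ℕ → ℕ → Word
encode f j zero    = one ∷ []
encode f j (suc m) = one ∷ twos j ++ one ∷ f j ++ one ∷ twos j ++ encode f (suc j) m

encode-head : ∀ f j m → ∃[ t ] encode f j m ≡ one ∷ t
encode-head f j zero    = [] , refl
encode-head f j (suc m) = _ , refl

encode-tagged : ∀ f j m i → i < m → Tagged (encode f j m) (j + i) (f (j + i))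
encode-tagged f j (suc m) zero    _ rewrite +-identityʳ j
  with t , p ← encode-head f (suc j) m =
  t , [] , cong (λ e → one ∷ twos j ++ one ∷ f j ++ one ∷ twos j ++ e) p
encode-tagged f j (suc m) (suc i) (s≤s i<m) rewrite +-suc j i
  with q , r ← encode-tagged f (suc j) m i i<m =
  q , ⊒-trans r (one ∷ twos j ++ one ∷ f j ++ one ∷ twos j , cong (one ∷_)
    (sym (trans (++-assoc (twos j) _ _) (cong (λ s → twos j ++ one ∷ s) (++-assoc (f j) _ _)))))

-- Unique readability of the code.

twos-too-long : ∀ {k} v {q t} → length v < k → ¬ twos k ++ q ≡ v ++ one ∷ t
twos-too-long {suc k} []      _         ()
twos-too-long {suc k} (x ∷ v) (s≤s v<k) p = twos-too-long v v<k (∷-injectiveʳ p)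

-- If `one ∷ twos k` started inside `v`, fewer than `k` letters of `v` would be left after its 1, so
-- the 2s would have to run over the 1 that follows `v`.
skip-word : ∀ {k} v {q t} → length v ≤ k → one ∷ twos k ++ q ⊒ v ++ one ∷ t →
  one ∷ twos k ++ q ⊒ one ∷ t
skip-word []      _   p            = p
skip-word (x ∷ v) v<k ([] , p)     =
  contradiction (sym (∷-injectiveʳ p)) (twos-too-long v v<k)
skip-word (x ∷ v) v<k (_ ∷ s , p) = skip-word v (<⇒≤ v<k) (s , ∷-injectiveʳ p)

-- Either the occurrence starts at the first letter, and the next 1 fixes the length of the tag, or
-- it starts later, but not within the run of 2s.
match-tag : ∀ {k} j {q t} → one ∷ twos k ++ one ∷ q ⊒ one ∷ twos j ++ one ∷ t →
  (k ≡ j × q ≡ t) ⊎ one ∷ twos k ++ one ∷ q ⊒ one ∷ t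
match-tag {k} j ([] , p)    = inj₁ (twos-one-injective k j (sym (∷-injectiveʳ p)))
match-tag     j (_ ∷ s , p) = inj₂ (strip-twos j (s , ∷-injectiveʳ p))

-- `v` cannot outlast `u`, as the tag after `u` would then run over the 1 after `v`. If `u` outlasts
-- `v`, the tag after `u` starts beyond that 1.
match-word : ∀ {k} u v {r t} → length v < k →
  u ++ one ∷ twos k ++ r ≡ v ++ one ∷ twos k ++ t →
  u ≡ v ⊎ one ∷ twos k ++ r ⊒ twos k ++ t
match-word []      []      _   p = inj₁ refl
match-word []      (x ∷ v) v<k p =
  contradiction (∷-injectiveʳ p) (twos-too-long v (<⇒≤ v<k))
match-word (y ∷ u) []      _   p = inj₂ (u , sym (∷-injectiveʳ p))
match-word (y ∷ u) (x ∷ v) v<k p with ∷-injective p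
... | refl , p′ with match-word u v (<⇒≤ v<k) p′
... | inj₁ refl = inj₁ refl
... | inj₂ r    = inj₂ r

-- The disjunction: the tag found is the opening or the closing one of its block.
locate-tag : ∀ f {k} → (∀ i → length (f i) < k) → ∀ j m {q} →
  one ∷ twos k ++ one ∷ q ⊒ encode f j m →
  ∃[ i ] ∃[ m′ ] k ≡ j + i × i < m ×
    (q ≡ f k ++ one ∷ twos k ++ encode f (suc k) m′ ⊎ one ∷ q ≡ encode f (suc k) m′)
locate-tag f {k} short j zero {q} (s , p) = contradiction p (too-short s)
  where
  too-short : ∀ s → ¬ one ∷ [] ≡ s ++ one ∷ twos k ++ one ∷ q
  too-short []      p = contradiction (++-conicalʳ (twos k) _ (sym (∷-injectiveʳ p))) λ ()
  too-short (_ ∷ s) p = contradiction (++-conicalʳ s _ (sym (∷-injectiveʳ p))) λ ()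
locate-tag f {k} short j (suc m) {q} p with match-tag j p
... | inj₁ (refl , q≡) = 0 , m , sym (+-identityʳ j) , s≤s z≤n , inj₁ q≡
... | inj₂ p₁ with encode-head f (suc j) m
... | t , e≡
  -- The word skipped is `f j` with the 1 before it; the strict bound on `f j` pays for this letter.
  with match-tag j (subst (λ e → one ∷ twos k ++ one ∷ q ⊒ one ∷ twos j ++ e) e≡
         (skip-word {k} (one ∷ f j) {one ∷ q} (short j) p₁))
... | inj₁ (refl , q≡) =
  0 , m , sym (+-identityʳ j) , s≤s z≤n , inj₂ (trans (cong (one ∷_) q≡) (sym e≡))
... | inj₂ p₂ with locate-tag f short (suc j) m (subst (one ∷ twos k ++ one ∷ q ⊒_) (sym e≡) p₂)
... | i , m′ , refl , i<m , r = suc i , m′ , sym (+-suc j i) , s≤s i<m , r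

-- With `suc k` for `j`, this excludes tag `k` from the code after its own block.
tag-bound : ∀ f {k} → (∀ i → length (f i) < k) → ∀ j m {q} →
  one ∷ twos k ++ one ∷ q ⊒ encode f j m → j ≤ k
tag-bound f short j m p with locate-tag f short j m p
... | i , _ , refl , _ = m≤m+n j i

-- The two tags around `u` must be the opening and the closing tag of one coded block: otherwise the
-- second would lie in the code of later blocks, whose tags exceed `k`.
decode : ∀ f {k} → (∀ i → length (f i) < k) → ∀ j m {u} → Tagged (encode f j m) k u →
  ∃[ i ] k ≡ j + i × i < m × u ≡ f k
decode f {k} short j m {u} (q , p) with locate-tag f short j m p
... | i , m′ , k≡ , i<m , inj₂ r =
  contradiction (tag-bound f short (suc k) m′ (one ∷ u , sym r)) (<-irrefl refl)
... | i , m′ , k≡ , i<m , inj₁ r with match-word u (f k) (short k) r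
... | inj₁ u≡ = i , k≡ , i<m , u≡
... | inj₂ s  =
  contradiction (tag-bound f short (suc k) m′ (strip-twos k s)) (<-irrefl refl)

-- Relations on words coded by a pair of words

Related : Word → Word → Word → Word → Word → Set
Related N w₁ w₂ u v = ∃[ m ] N ⊑ twos m × Tagged w₁ m u × Tagged w₂ m v

-- N serves as a lower bound for the tags, as shorter ones may occur in the coded
-- words.
`Related : Fin n → Fin n → Fin n → Fin n → Fin n → Formula n
`Related N w₁ w₂ u v = `∃ `Twos 0F `∧ var (suc N) `⊑ var 0F `∧
  `Tagged (suc w₁) 0F (suc u) `∧ `Tagged (suc w₂) 0F (suc v)

related : ∀ (N w₁ w₂ u v : Fin n) ρ → (𝔖₁ ⊨ `Related N w₁ w₂ u v [ ρ ]) ⇔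
  Related (lookup ρ N) (lookup ρ w₁) (lookup ρ w₂) (lookup ρ u) (lookup ρ v)
related N w₁ w₂ u v ρ = mk⇔
  (λ (k , isTwos , N⊑k , t₁ , t₂) → let m , k≡ = to (twos-sat 0F (k ∷ ρ)) isTwos in
    m , subst (lookup ρ N ⊑_) k≡ N⊑k ,
    to (tagged (suc w₁) 0F (suc u) (k ∷ ρ) m k≡) t₁ ,
    to (tagged (suc w₂) 0F (suc v) (k ∷ ρ) m k≡) t₂)
  (λ (m , N⊑k , t₁ , t₂) →
    twos m , from (twos-sat 0F (twos m ∷ ρ)) (m , refl) , N⊑k ,
    from (tagged (suc w₁) 0F (suc u) (twos m ∷ ρ) m refl) t₁ ,
    from (tagged (suc w₂) 0F (suc v) (twos m ∷ ρ) m refl) t₂)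

-- The vocabulary has no constant for the empty word, but it is the only common initial segment of 1
-- and 2.
`Empty : Fin n → Formula n
`Empty v = var v `⊑ `1 `∧ var v `⊑ `2

empty : ∀ (v : Fin n) ρ → (𝔖₁ ⊨ `Empty v [ ρ ]) ⇔ (lookup ρ v ≡ [])
empty v ρ = mk⇔ (sound (lookup ρ v)) λ p →
  subst (λ V → V ⊑ one ∷ [] × V ⊑ two ∷ []) (sym p) ((_ , refl) , (_ , refl))
  where
  sound : ∀ V → V ⊑ one ∷ [] × V ⊑ two ∷ [] → V ≡ []
  sound []      _                     = refl
  sound (_ ∷ _) ((_ , p) , (_ , q)) =
    contradiction (trans (∷-injectiveˡ p) (sym (∷-injectiveˡ q))) λ ()

Step : (Word → Word → Set) → Word → Word → Word → Set
Step R x u v = (u ≡ x × v ≡ []) ⊎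
  ∃[ a ] ∃[ u′ ] ∃[ v′ ] u ≡ u′ ∷ʳ a × v ≡ v′ ∷ʳ a × R u′ v′

`Step : (N w₁ w₂ x u v : Fin n) → Formula n
`Step N w₁ w₂ x u v =
  (var u `≡ var x `∧ `Empty v) `∨
  (`∃ `∃ (`Snoc one 1F (2 ↑ʳ u) `∧ `Snoc one 0F (2 ↑ʳ v) `∨
          `Snoc two 1F (2 ↑ʳ u) `∧ `Snoc two 0F (2 ↑ʳ v)) `∧
         `Related (2 ↑ʳ N) (2 ↑ʳ w₁) (2 ↑ʳ w₂) 1F 0F)

step : ∀ (N w₁ w₂ x u v : Fin n) ρ → (𝔖₁ ⊨ `Step N w₁ w₂ x u v [ ρ ]) ⇔
  Step (Related (lookup ρ N) (lookup ρ w₁) (lookup ρ w₂)) (lookup ρ x) (lookup ρ u) (lookup ρ v)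
step {n} N w₁ w₂ x u v ρ = mk⇔ sound complete
  where
  R = Related (lookup ρ N) (lookup ρ w₁) (lookup ρ w₂)

  extend : Word → Word → Vec Word (2 + n)
  extend u′ v′ = v′ ∷ u′ ∷ ρ

  relatedIn : ∀ u′ v′ →
    (𝔖₁ ⊨ `Related (2 ↑ʳ N) (2 ↑ʳ w₁) (2 ↑ʳ w₂) 1F 0F [ extend u′ v′ ]) ⇔ R u′ v′
  relatedIn u′ v′ = related (2 ↑ʳ N) (2 ↑ʳ w₁) (2 ↑ʳ w₂) 1F 0F (extend u′ v′)

  snocU : ∀ a u′ v′ → (𝔖₁ ⊨ `Snoc a 1F (2 ↑ʳ u) [ extend u′ v′ ]) ⇔ (lookup ρ u ≡ u′ ∷ʳ a)
  snocU a u′ v′ = snoc a 1F (2 ↑ʳ u) (extend u′ v′)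

  snocV : ∀ a u′ v′ → (𝔖₁ ⊨ `Snoc a 0F (2 ↑ʳ v) [ extend u′ v′ ]) ⇔ (lookup ρ v ≡ v′ ∷ʳ a)
  snocV a u′ v′ = snoc a 0F (2 ↑ʳ v) (extend u′ v′)

  sound : 𝔖₁ ⊨ `Step N w₁ w₂ x u v [ ρ ] → Step R (lookup ρ x) (lookup ρ u) (lookup ρ v)
  sound (inj₁ (p , q)) = inj₁ (p , to (empty v ρ) q)
  sound (inj₂ (u′ , v′ , inj₁ (p , q) , r)) = inj₂ (one , u′ , v′ ,
    to (snocU one u′ v′) p , to (snocV one u′ v′) q , to (relatedIn u′ v′) r)
  sound (inj₂ (u′ , v′ , inj₂ (p , q) , r)) = inj₂ (two , u′ , v′ ,
    to (snocU two u′ v′) p , to (snocV two u′ v′) q , to (relatedIn u′ v′) r)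

  complete : Step R (lookup ρ x) (lookup ρ u) (lookup ρ v) → 𝔖₁ ⊨ `Step N w₁ w₂ x u v [ ρ ]
  complete (inj₁ (p , q)) = inj₁ (p , from (empty v ρ) q)
  complete (inj₂ (one , u′ , v′ , p , q , r)) = inj₂ (u′ , v′ ,
    inj₁ (from (snocU one u′ v′) p , from (snocV one u′ v′) q) , from (relatedIn u′ v′) r)
  complete (inj₂ (two , u′ , v′ , p , q , r)) = inj₂ (u′ , v′ ,
    inj₂ (from (snocU two u′ v′) p , from (snocV two u′ v′) q) , from (relatedIn u′ v′) r)

-- The defining formula and its soundness.

`Concat : Formula 3
-- The outer quantifiers bind `N`, `w₁`, `w₂`, so `5F 4F` are the third and second arguments; under
-- the inner two, which bind `u` and `v`, `5F` is the first argument.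
`Concat = `∃ `∃ `∃ `Related 2F 1F 0F 5F 4F `∧
  (`∀ `∀ `Related 4F 3F 2F 1F 0F `⇒ `Step 4F 3F 2F 5F 1F 0F)

-- The recursion runs on the length `ℓ` because each step removes the last letter of `v`, which is
-- not a structural descent on lists.
step-closed⇒++ : ∀ {R x} → (∀ u v → R u v → Step R x u v) →
  ∀ ℓ u v → length v ≡ ℓ → R u v → x ++ v ≡ u
step-closed⇒++ {x = x} closed ℓ u v v≡ r with closed u v r
step-closed⇒++ {x = x} closed ℓ u v v≡ r | inj₁ (refl , refl) = ++-identityʳ x
step-closed⇒++ {x = x} closed zero u v v≡ r | inj₂ (a , u′ , v′ , refl , refl , r′) =
  contradiction (trans (sym (length-++-comm v′ (a ∷ []))) v≡) λ ()
step-closed⇒++ {x = x} closed (suc ℓ) u v v≡ r | inj₂ (a , u′ , v′ , refl , refl , r′) =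
  trans (sym (++-assoc x v′ (a ∷ [])))
    (cong (_∷ʳ a) (step-closed⇒++ closed ℓ u′ v′
      (suc-injective (trans (sym (length-++-comm v′ (a ∷ []))) v≡)) r′))

-- Completeness: coding the initial segments of `y`.

take-snoc : ∀ i (y : Word) → i < length y → ∃[ a ] take (suc i) y ≡ take i y ∷ʳ a
take-snoc zero    (b ∷ y) _         = b , refl
take-snoc (suc i) (b ∷ y) (s≤s i<y) with a , p ← take-snoc i y i<y = a , cong (b ∷_) p

module Witness (x y : Word) where

  base size : ℕ
  -- Every tag is at least `base`, hence longer than each coded word; `size` counts the initial
  -- segments of `y`, from the empty one to `y` itself.
  base = suc (length x + length y)
  size = suc (length y)

  -- `encode` passes the tag itself, so subtracting `base` recovers the number of letters taken from
  -- `y`.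
  f g : ℕ → Word
  g k = take (k ∸ base) y
  f k = x ++ g k

  w₁ w₂ : Word
  w₁ = encode f base size
  w₂ = encode g base size

  R : Word → Word → Set
  R = Related (twos base) w₁ w₂

  length-g : ∀ k → length (g k) ≤ length y
  length-g k = ≤-trans (≤-reflexive (length-take (k ∸ base) y)) (m⊓n≤n (k ∸ base) (length y))

  f-short : ∀ k → length (f k) < base
  f-short k = s≤s (≤-trans (≤-reflexive (length-++ x)) (+-monoʳ-≤ (length x) (length-g k)))

  g-short : ∀ k → length (g k) < base
  g-short k = s≤s (≤-trans (length-g k) (m≤n+m (length y) (length x)))

  R-intro : ∀ i → i < size → R (x ++ take i y) (take i y)
  R-intro i i<size = base + i ,
    (twos i , ++-replicate base i) ,
    subst (λ j → Tagged w₁ (base + i) (x ++ take j y)) (m+n∸m≡n base i)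
      (encode-tagged f base size i i<size) ,
    subst (λ j → Tagged w₂ (base + i) (take j y)) (m+n∸m≡n base i)
      (encode-tagged g base size i i<size)
    where
    ++-replicate : ∀ j k → twos (j + k) ≡ twos j ++ twos k
    ++-replicate zero    k = refl
    ++-replicate (suc j) k = cong (two ∷_) (++-replicate j k)

  -- The lower bound on the tag makes `decode` applicable to both codes, and the shared tag forces
  -- the same `i` in both.
  R-elim : ∀ {u v} → R u v → ∃[ i ] i < size × u ≡ x ++ take i y × v ≡ take i y
  R-elim {u} {v} (k , (c , N⊑k) , t₁ , t₂)
    with decode f (λ j → ≤-trans (f-short j) base≤k) base size t₁
       | decode g (λ j → ≤-trans (g-short j) base≤k) base size t₂
    where
    base≤k : base ≤ k
    base≤k = ≤-trans (m≤m+n base (length c)) (≤-reflexive (sym (begin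
      k                               ≡⟨ length-replicate k ⟨
      length (twos k)                 ≡⟨ cong length N⊑k ⟩
      length (twos base ++ c)         ≡⟨ length-++ (twos base) ⟩
      length (twos base) + length c   ≡⟨ cong (_+ length c) (length-replicate base) ⟩
      base + length c                 ∎)))
      where open ≡-Reasoning
  ... | i , refl , i<size , u≡ | _ , _ , _ , v≡ = i , i<size ,
    trans u≡ (cong (λ j → x ++ take j y) (m+n∸m≡n base i)) ,
    trans v≡ (cong (λ j → take j y) (m+n∸m≡n base i))

  R-goal : R (x ++ y) y
  R-goal = subst (λ v → R (x ++ v) v) (take-all (length y) y ≤-refl) (R-intro (length y) ≤-refl)

  -- Dropping the last letter of an initial segment of `y` gives another one, whose pair is coded
  -- too; length 0 is the starting pair.
  R-closed : ∀ u v → R u v → Step R x u v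
  R-closed u v r with R-elim r
  ... | zero  , _ , u≡ , v≡ = inj₁ (trans u≡ (++-identityʳ x) , v≡)
  ... | suc i , s≤s i<y , refl , refl with take-snoc i y i<y
  ... | a , p = inj₂ (a , x ++ take i y , take i y ,
    trans (cong (x ++_) p) (sym (++-assoc x (take i y) (a ∷ []))) , p ,
    R-intro i (m≤n⇒m≤1+n i<y))

theorem9p2 : Σ[ φ ∈ Formula 3 ] (∀ (r s t : Word) → (𝔖₁ ⊨ φ [ r ∷ s ∷ t ∷ [] ]) ⇔ (r ++ s ≡ t))
theorem9p2 = `Concat , λ r s t → mk⇔ (sound r s t) λ { refl → complete r s }
  where
  sound : ∀ r s t → 𝔖₁ ⊨ `Concat [ r ∷ s ∷ t ∷ [] ] → r ++ s ≡ t
  sound r s t (N , w₁ , w₂ , goal , closed) =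
    step-closed⇒++
      (λ u v rel → let ρ = v ∷ u ∷ w₂ ∷ w₁ ∷ N ∷ r ∷ s ∷ t ∷ [] in
        to (step 4F 3F 2F 5F 1F 0F ρ)
          (closed u v (from (related 4F 3F 2F 1F 0F ρ) rel)))
      (length s) t s refl
      (to (related 2F 1F 0F 5F 4F (w₂ ∷ w₁ ∷ N ∷ r ∷ s ∷ t ∷ [])) goal)

  complete : ∀ r s → 𝔖₁ ⊨ `Concat [ r ∷ s ∷ (r ++ s) ∷ [] ]
  complete r s = twos base , w₁ , w₂ ,
    from (related 2F 1F 0F 5F 4F
      (w₂ ∷ w₁ ∷ twos base ∷ r ∷ s ∷ (r ++ s) ∷ [])) R-goal ,
    λ u v rel → let ρ = v ∷ u ∷ w₂ ∷ w₁ ∷ twos base ∷ r ∷ s ∷ (r ++ s) ∷ [] in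
      from (step 4F 3F 2F 5F 1F 0F ρ)
        (R-closed u v (to (related 4F 3F 2F 1F 0F ρ) rel))
    where open Witness r s
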